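{- Let $x$ and $y$ be BARTC terms. If $\mathrm{BARTC}\vdash x=y$, then $x\sim_s^{fr}y$ (FR step bisimilarity).
   Context: Events. $\langle\mathbb E,\le,\sharp,\lambda\rangle$ is a prime event structure: $\mathbb E$ is a denumerable set of events, $\lambda:\mathbb E\to\Lambda$ a labelling, $\le$ (causality) a partial order with $\{e'\mid e'\le e\}$ finite for every $e$, and $\sharp$ (conflict) an irreflexive symmetric relation such that $e\sharp e'\le e''$ implies $e\sharp e''$. Two events are concurrent if they are related by none of $\le,\ge,\sharp$. For $e\in\mathbb E$, $m\in\mathbb N$, $e[m]$ denotes the past (history) of $e$; $\mathbb E$ is extended by all histories. $X[\mathcal K]$ ($\mathcal K\subseteq\mathbb N$) contains for each $e\in X$ a history $e[m]$ with $m\in\mathcal K$. $X\sim Y$ means $X,Y$ are isomorphic as pomsets (labelled partial orders). Everything is image finite. BARTC terms are built from variables and constants (events $e$ and histories $e[m]$) with the binary operators $\cdot$ (causality) and $+$ (conflict); closed terms have no variables. $Std(x)$: $x$ contains only events, no histories; $NStd(x)$: $x$ contains only histories. $\mathrm{BARTC}\vdash x=y$ means derivability in equational logic from: (A1) $x+y=y+x$; (A2) $(x+y)+z=x+(y+z)$; (A3) $x+x=x$; (A41) $(x+y)\cdot z=x\cdot z+y\cdot z$ if $Std(x),Std(y),Std(z)$; (A42) $x\cdot(y+z)=x\cdot y+x\cdot z$ if $NStd(x),NStd(y),NStd(z)$; (A5) $(x\cdot y)\cdot z=x\cdot(y\cdot z)$. Step transitions. $\xrightarrow{X}$ is forward,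 $\overset{X[\mathcal K]}{\twoheadrightarrow}$ is reverse; labels are nonempty pomsets whose events are pairwise concurrent, and $X\subseteq x$ means the events of $X$ occur in $x$. Forward rules: $X\xrightarrow{X}X[\mathcal K]$; if $x\xrightarrow{X}u$ with $X\subseteq x$ ($u$ is $X[\mathcal K]$ or a term $x'$), then $x+y\xrightarrow{X}u$, $y+x\xrightarrow{X}u$ and $x\cdot y\xrightarrow{X}u\cdot y$. Reverse rules: $X[\mathcal K]\overset{X[\mathcal K]}{\twoheadrightarrow}X$; if $x\overset{X[\mathcal K]}{\twoheadrightarrow}u$ with $X\subseteq x$ ($u$ is $X$ or a term $x'$), then $x+y\overset{X[\mathcal K]}{\twoheadrightarrow}u$, $y+x\overset{X[\mathcal K]}{\twoheadrightarrow}u$ and $y\cdot x\overset{X[\mathcal K]}{\twoheadrightarrow}y\cdot u$. An FR step bisimulation is a relation $R$ on states (process terms) such that for $(s,t)\in R$: (1) for every step $s\xrightarrow{X_1}s'$ there is a step $t\xrightarrow{X_2}t'$ with $X_2\sim X_1$ and $(s',t')\in R$, and vice versa; (2) for every reverse step $s\overset{X_1[\mathcal K_1]}{\twoheadrightarrow}s'$ there is a reverse step $t\overset{X_2[\mathcal K_2]}{\twoheadrightarrow}t'$ with $X_2\sim X_1$ and $(s',t')\in R$, and vice versa. $x\sim_s^{fr}y$ iff some FR step bisimulation contains $(x,y)$; for terms with variables this is required of all closed substitution instances. -}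

module Defs where

open import Data.Empty using (⊥)
open import Data.Unit using (⊤)
open import Data.Nat.Base using (ℕ; suc)
open import Data.Fin.Base using (Fin)
open import Data.List.Base using (List)
import Data.List.Membership.Propositional as List
open import Data.Product.Base using (_×_; _,_; ∃-syntax)
open import Data.Sum.Base using (_⊎_)
open import Data.Vec.Base using (Vec; []; _∷_; lookup)
import Data.Vec.Membership.Propositional as Vec
open import Data.Vec.Relation.Unary.All using ([])
open import Data.Vec.Relation.Unary.AllPairs using (AllPairs; []; _∷_)
open import Function.Bundles using (_⇔_; _↔_; _↣_; module Inverse)
open import Relation.Binary.Core using (Rel)
open import Relation.Binary.Definitions using (Irreflexive; Symmetric)
open import Relation.Binary.Structures using (IsPartialOrder)
open import Relation.Binary.PropositionalEquality.Core using (_≡_)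
open import Relation.Nullary.Negation.Core using (¬_)
open import Level using (0ℓ)

record PrimeEventStructure (Λ : Set) : Set₁ where
  infix 4 _≤_ _♯_ _∥_
  field
    Event          : Set
    -- Countable, possibly finite.
    denumerable    : Event ↣ ℕ
    _≤_            : Rel Event 0ℓ
    _♯_            : Rel Event 0ℓ
    λab            : Event → Λ
    isPartialOrder : IsPartialOrder _≡_ _≤_
    finiteCauses   : ∀ e → ∃[ es ] (∀ e′ → e′ ≤ e ⇔ e′ List.∈ es)
    ♯-irrefl       : Irreflexive _≡_ _♯_
    ♯-sym          : Symmetric _♯_
    ♯-hereditary   : ∀ {e e′ e″} → e ♯ e′ → e′ ≤ e″ → e ♯ e″

  _∥_ : Rel Event 0ℓ
  e ∥ e′ = ¬ (e ≤ e′) × ¬ (e′ ≤ e) × ¬ (e ♯ e′)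

record Pomset (Λ : Set) : Set₁ where
  field
    Carrier : Set
    _⊑_     : Rel Carrier 0ℓ
    label   : Carrier → Λ

record _≅_ {Λ : Set} (P Q : Pomset Λ) : Set where
  private
    module P = Pomset P
    module Q = Pomset Q
  field
    bijection : P.Carrier ↔ Q.Carrier
  open Inverse bijection using (to)
  field
    order  : ∀ p p′ → p P.⊑ p′ ⇔ to p Q.⊑ to p′
    labels : ∀ p → P.label p ≡ Q.label (to p)

infixl 7 _·_
infixl 6 _+_

-- C is the set of constants and V the set of variables.
data Term (C V : Set) : Set where
  var : V → Term C V
  con : C → Term C V
  _·_ : Term C V → Term C V → Term C V
  _+_ : Term C V → Term C V → Term C V

-- Simultaneous substitution for constants and variables.
substitute : ∀ {C V C′ V′} → (C → Term C′ V′) → (V → Term C′ V′) →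
             Term C V → Term C′ V′
substitute f σ (var v) = σ v
substitute f σ (con c) = f c
substitute f σ (x · y) = substitute f σ x · substitute f σ y
substitute f σ (x + y) = substitute f σ x + substitute f σ y

module BARTC {Λ : Set} (𝔼 : PrimeEventStructure Λ) where
  open PrimeEventStructure 𝔼

  data Constant : Set where
    event   : Event → Constant
    history : Event → ℕ → Constant      -- history e m is e[m]

  BTerm : Set
  BTerm = Term Constant ℕ

  ClosedBTerm : Set
  ClosedBTerm = Term Constant ⊥

  _⟨_⟩ : ∀ {V V′} → Term Constant V → (V → Term Constant V′) → Term Constant V′
  x ⟨ σ ⟩ = substitute con σ x

  -- Every leaf has to be an event (respectively a history).  In particular a
  -- variable, which may be instantiated by either, satisfies neither predicate.
  Std : BTerm → Set
  Std (var _)             = ⊥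
  Std (con (event _))     = ⊤
  Std (con (history _ _)) = ⊥
  Std (x · y)             = Std x × Std y
  Std (x + y)             = Std x × Std y

  NStd : BTerm → Set
  NStd (var _)             = ⊥
  NStd (con (event _))     = ⊥
  NStd (con (history _ _)) = ⊤
  NStd (x · y)             = NStd x × NStd y
  NStd (x + y)             = NStd x × NStd y

  infix 4 ⊢_≐_

  data ⊢_≐_ : BTerm → BTerm → Set where
    A1  : ∀ x y → ⊢ x + y ≐ y + x
    A2  : ∀ x y z → ⊢ (x + y) + z ≐ x + (y + z)
    A3  : ∀ x → ⊢ x + x ≐ x
    A41 : ∀ x y z → Std x → Std y → Std z →
          ⊢ (x + y) · z ≐ x · z + y · z
    A42 : ∀ x y z → NStd x → NStd y → NStd z →
          ⊢ x · (y + z) ≐ x · y + x · z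
    A5  : ∀ x y z → ⊢ (x · y) · z ≐ x · (y · z)
    ≐-refl  : ∀ {x} → ⊢ x ≐ x
    ≐-sym   : ∀ {x y} → ⊢ x ≐ y → ⊢ y ≐ x
    ≐-trans : ∀ {x y z} → ⊢ x ≐ y → ⊢ y ≐ z → ⊢ x ≐ z
    ·-cong  : ∀ {x x′ y y′} → ⊢ x ≐ x′ → ⊢ y ≐ y′ → ⊢ x · y ≐ x′ · y′
    +-cong  : ∀ {x x′ y y′} → ⊢ x ≐ x′ → ⊢ y ≐ y′ → ⊢ x + y ≐ x′ + y′
    ≐-subst : ∀ {x y} (σ : ℕ → BTerm) → ⊢ x ≐ y → ⊢ x ⟨ σ ⟩ ≐ y ⟨ σ ⟩

  -- A nonempty finite set of pairwise concurrent events.  The enumeration has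
  -- no repetitions, because ≤ is reflexive and hence no event satisfies e ∥ e.
  record Step : Set where
    field
      {pred-size} : ℕ
      events      : Vec Event (suc pred-size)
      concurrent  : AllPairs _∥_ events

    size : ℕ
    size = suc pred-size

  open Step

  singleton : Event → Step
  singleton e = record { events = e ∷ [] ; concurrent = [] ∷ [] }

  pomset : Step → Pomset Λ
  pomset X = record
    { Carrier = Fin (size X)
    ; _⊑_     = λ i j → lookup (events X) i ≤ lookup (events X) j
    ; label   = λ i → λab (lookup (events X) i)
    }

  infix 4 _∼_

  _∼_ : Rel Step 0ℓ
  X ∼ Y = pomset X ≅ pomset Y

  -- X[𝒦] is X together with the key m ∈ 𝒦 of the history e[m] that it contains
  -- for each e ∈ X; the i-th key belongs to the i-th event of X.
  Keys : Step → Set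
  Keys X = Vec ℕ (size X)

  data StepConstant : Set where
    step : Step → StepConstant
    past : (X : Step) → Keys X → StepConstant      -- past X 𝒦 is X[𝒦]

  -- The rules X → X[𝒦] and X[𝒦] ↠ X mention X and X[𝒦] as states for arbitrary
  -- X, so states are closed terms over steps and their pasts.  Those reachable
  -- from a closed term over events and histories involve only singleton steps.
  State : Set
  State = Term StepConstant ⊥

  constant : Constant → StepConstant
  constant (event e)     = step (singleton e)
  constant (history e m) = past (singleton e) (m ∷ [])

  state : ClosedBTerm → State
  state = substitute (λ c → con (constant c)) (λ ())

  -- An event occurs in a state also when it does so as a history: otherwise the
  -- premise X ⊆ x would disable every reverse step of a compound state.
  _occursIn_ : Event → State → Set
  e occursIn con (step X)   = e Vec.∈ events X
  e occursIn con (past X _) = e Vec.∈ events X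
  e occursIn (x · y)        = e occursIn x ⊎ e occursIn y
  e occursIn (x + y)        = e occursIn x ⊎ e occursIn y

  infix 4 _⊆_

  _⊆_ : Step → State → Set
  X ⊆ x = ∀ {e} → e Vec.∈ events X → e occursIn x

  infix 4 _─[_]→_ _─[_⟦_⟧]↠_

  data _─[_]→_ : State → Step → State → Set where
    act : ∀ {X} 𝒦 → con (step X) ─[ X ]→ con (past X 𝒦)
    +ˡ  : ∀ {x y X u} → x ─[ X ]→ u → X ⊆ x → x + y ─[ X ]→ u
    +ʳ  : ∀ {x y X u} → x ─[ X ]→ u → X ⊆ x → y + x ─[ X ]→ u
    ·ˡ  : ∀ {x y X u} → x ─[ X ]→ u → X ⊆ x → x · y ─[ X ]→ u · y

  data _─[_⟦_⟧]↠_ : State → (X : Step) → Keys X → State → Set where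
    undo : ∀ {X 𝒦} → con (past X 𝒦) ─[ X ⟦ 𝒦 ⟧]↠ con (step X)
    +ˡ   : ∀ {x y X 𝒦 u} → x ─[ X ⟦ 𝒦 ⟧]↠ u → X ⊆ x → x + y ─[ X ⟦ 𝒦 ⟧]↠ u
    +ʳ   : ∀ {x y X 𝒦 u} → x ─[ X ⟦ 𝒦 ⟧]↠ u → X ⊆ x → y + x ─[ X ⟦ 𝒦 ⟧]↠ u
    ·ʳ   : ∀ {x y X 𝒦 u} → x ─[ X ⟦ 𝒦 ⟧]↠ u → X ⊆ x → y · x ─[ X ⟦ 𝒦 ⟧]↠ y · u

  record IsFRStepBisimulation (R : Rel State 0ℓ) : Set where
    field
      forward→ : ∀ {s t s′ X₁} → R s t → s ─[ X₁ ]→ s′ →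
                 ∃[ X₂ ] ∃[ t′ ] t ─[ X₂ ]→ t′ × X₂ ∼ X₁ × R s′ t′
      forward← : ∀ {s t t′ X₂} → R s t → t ─[ X₂ ]→ t′ →
                 ∃[ X₁ ] ∃[ s′ ] s ─[ X₁ ]→ s′ × X₂ ∼ X₁ × R s′ t′
      reverse→ : ∀ {s t s′ X₁ 𝒦₁} → R s t → s ─[ X₁ ⟦ 𝒦₁ ⟧]↠ s′ →
                 ∃[ X₂ ] ∃[ 𝒦₂ ] ∃[ t′ ]
                   t ─[ X₂ ⟦ 𝒦₂ ⟧]↠ t′ × X₂ ∼ X₁ × R s′ t′
      reverse← : ∀ {s t t′ X₂ 𝒦₂} → R s t → t ─[ X₂ ⟦ 𝒦₂ ⟧]↠ t′ →
                 ∃[ X₁ ] ∃[ 𝒦₁ ] ∃[ s′ ]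
                   s ─[ X₁ ⟦ 𝒦₁ ⟧]↠ s′ × X₂ ∼ X₁ × R s′ t′

  infix 4 _∼ˢᶠʳ_ _≈ˢᶠʳ_

  _∼ˢᶠʳ_ : State → State → Set₁
  s ∼ˢᶠʳ t = ∃[ R ] IsFRStepBisimulation R × R s t

  _≈ˢᶠʳ_ : BTerm → BTerm → Set₁
  x ≈ˢᶠʳ y = ∀ (ρ : ℕ → ClosedBTerm) → state (x ⟨ ρ ⟩) ∼ˢᶠʳ state (y ⟨ ρ ⟩)

{-# OPTIONS --safe #-}

-- Every law is sound with identical step labels and identical keys, so the
-- congruence generated by the laws on states is itself an FR step bisimulation.
-- The side conditions of A41 and A42 ensure that the step which could tell the
-- two sides apart does not exist: z cannot be reversed, respectively x cannot be
-- executed.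
module Submission where

open import Defs
open import Data.Nat.Base using (ℕ)
open import Data.Product.Base using (_×_; _,_; ∃-syntax; proj₁; proj₂; swap)
open import Data.Sum.Base using (inj₁; inj₂)
open import Function.Base using (id; _∘_)
open import Function.Construct.Identity using (↔-id; ⇔-id)
open import Relation.Binary.PropositionalEquality
  using (_≡_; refl; sym; cong₂; subst₂)
open import Relation.Nullary using (¬_; contradiction)

≅-refl : ∀ {Λ : Set} {P : Pomset Λ} → P ≅ P
≅-refl = record
  { bijection = ↔-id _
  ; order     = λ _ _ → ⇔-id _
  ; labels    = λ _ → refl
  }

module Soundness {Λ : Set} (𝔼 : PrimeEventStructure Λ) where
  open BARTC 𝔼

  -- Serves the substitution rule of the calculus: instantiating by `σ` and then closing by `ρ` is
  -- itself one closing substitution.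
  ⟨⟩-fusion : ∀ {U V W} (σ : U → Term Constant V) (ρ : V → Term Constant W) →
              ∀ x → x ⟨ σ ⟩ ⟨ ρ ⟩ ≡ x ⟨ (λ v → σ v ⟨ ρ ⟩) ⟩
  ⟨⟩-fusion σ ρ (var v) = refl
  ⟨⟩-fusion σ ρ (con c) = refl
  ⟨⟩-fusion σ ρ (x · y) = cong₂ _·_ (⟨⟩-fusion σ ρ x) (⟨⟩-fusion σ ρ y)
  ⟨⟩-fusion σ ρ (x + y) = cong₂ _+_ (⟨⟩-fusion σ ρ x) (⟨⟩-fusion σ ρ y)

  -- Makes the premise `X ⊆ x` of the compound rules automatic, so that transitions can be rebuilt
  -- around a subterm without supplying it.
  →⇒⊆ : ∀ {x X u} → x ─[ X ]→ u → X ⊆ x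
  →⇒⊆ (act _)   = id
  →⇒⊆ (+ˡ _ X⊆) = inj₁ ∘ X⊆
  →⇒⊆ (+ʳ _ X⊆) = inj₂ ∘ X⊆
  →⇒⊆ (·ˡ _ X⊆) = inj₁ ∘ X⊆

  ↠⇒⊆ : ∀ {x X 𝒦 u} → x ─[ X ⟦ 𝒦 ⟧]↠ u → X ⊆ x
  ↠⇒⊆ undo      = id
  ↠⇒⊆ (+ˡ _ X⊆) = inj₁ ∘ X⊆
  ↠⇒⊆ (+ʳ _ X⊆) = inj₂ ∘ X⊆
  ↠⇒⊆ (·ʳ _ X⊆) = inj₂ ∘ X⊆

  Unexecutable : State → Set
  Unexecutable x = ∀ {X u} → ¬ (x ─[ X ]→ u)

  Irreversible : State → Set
  Irreversible x = ∀ {X 𝒦 u} → ¬ (x ─[ X ⟦ 𝒦 ⟧]↠ u)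

  -- Every reverse step is built on an `undo` at a `past` leaf. A `Std` term has event leaves and no
  -- variables, so `ρ` cannot bring in a history.
  Std⇒Irreversible : ∀ ρ x → Std x → Irreversible (state (x ⟨ ρ ⟩))
  Std⇒Irreversible ρ (con (event _)) _       ()
  Std⇒Irreversible ρ (x · y) (_ , sy) (·ʳ t _) = Std⇒Irreversible ρ y sy t
  Std⇒Irreversible ρ (x + y) (sx , _) (+ˡ t _) = Std⇒Irreversible ρ x sx t
  Std⇒Irreversible ρ (x + y) (_ , sy) (+ʳ t _) = Std⇒Irreversible ρ y sy t

  -- Dually, every forward step is built on an `act` at a `step` leaf, and all leaves here are
  -- histories.
  NStd⇒Unexecutable : ∀ ρ x → NStd x → Unexecutable (state (x ⟨ ρ ⟩))
  NStd⇒Unexecutable ρ (con (history _ _)) _     ()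
  NStd⇒Unexecutable ρ (x · y) (nx , _) (·ˡ t _) = NStd⇒Unexecutable ρ x nx t
  NStd⇒Unexecutable ρ (x + y) (nx , _) (+ˡ t _) = NStd⇒Unexecutable ρ x nx t
  NStd⇒Unexecutable ρ (x + y) (_ , ny) (+ʳ t _) = NStd⇒Unexecutable ρ y ny t

  infix 4 _≃_

  -- The distributive laws are guarded by the absence of transitions, a condition that makes sense
  -- for arbitrary states and is what the matching of steps uses.
  data _≃_ : State → State → Set where
    +-comm    : ∀ {x y} → x + y ≃ y + x
    +-assoc   : ∀ {x y z} → (x + y) + z ≃ x + (y + z)
    +-idem    : ∀ {x} → x + x ≃ x
    ·-distʳ-+ : ∀ {x y z} → Irreversible z → (x + y) · z ≃ x · z + y · z
    ·-distˡ-+ : ∀ {x y z} → Unexecutable x → x · (y + z) ≃ x · y + x · z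
    ·-assoc   : ∀ {x y z} → (x · y) · z ≃ x · (y · z)
    ≃-refl    : ∀ {x} → x ≃ x
    ≃-sym     : ∀ {x y} → x ≃ y → y ≃ x
    ≃-trans   : ∀ {x y z} → x ≃ y → y ≃ z → x ≃ z
    ·-cong    : ∀ {x x′ y y′} → x ≃ x′ → y ≃ y′ → x · y ≃ x′ · y′
    +-cong    : ∀ {x x′ y y′} → x ≃ x′ → y ≃ y′ → x + y ≃ x′ + y′

  -- Induction on the derivation, with `ρ` left general because the substitution rule calls the
  -- hypothesis at `σ` composed with `ρ`.
  ⊢⇒≃ : ∀ {x y} → ⊢ x ≐ y → (ρ : ℕ → ClosedBTerm) →
        state (x ⟨ ρ ⟩) ≃ state (y ⟨ ρ ⟩)
  ⊢⇒≃ (A1 _ _)             ρ = +-comm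
  ⊢⇒≃ (A2 _ _ _)           ρ = +-assoc
  ⊢⇒≃ (A3 _)               ρ = +-idem
  ⊢⇒≃ (A41 _ _ z _ _ sz)   ρ = ·-distʳ-+ (Std⇒Irreversible ρ z sz)
  ⊢⇒≃ (A42 x _ _ nx _ _)   ρ = ·-distˡ-+ (NStd⇒Unexecutable ρ x nx)
  ⊢⇒≃ (A5 _ _ _)           ρ = ·-assoc
  ⊢⇒≃ ≐-refl               ρ = ≃-refl
  ⊢⇒≃ (≐-sym p)            ρ = ≃-sym (⊢⇒≃ p ρ)
  ⊢⇒≃ (≐-trans p q)        ρ = ≃-trans (⊢⇒≃ p ρ) (⊢⇒≃ q ρ)
  ⊢⇒≃ (·-cong p q)         ρ = ·-cong (⊢⇒≃ p ρ) (⊢⇒≃ q ρ)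
  ⊢⇒≃ (+-cong p q)         ρ = +-cong (⊢⇒≃ p ρ) (⊢⇒≃ q ρ)
  ⊢⇒≃ (≐-subst {x} {y} σ p) ρ =
    subst₂ (λ s t → state s ≃ state t)
      (sym (⟨⟩-fusion σ ρ x)) (sym (⟨⟩-fusion σ ρ y))
      (⊢⇒≃ p (λ v → σ v ⟨ ρ ⟩))

  -- The label is fixed inside `_⟶_`, so a match has literally the same label, and one development
  -- serves both directions of execution.
  module Simulation (_⟶_ : State → State → Set) where

    Simulates : State → State → Set
    Simulates s t = ∀ {s′} → s ⟶ s′ → ∃[ t′ ] t ⟶ t′ × s′ ≃ t′

    Matches : State → State → Set
    Matches s t = Simulates s t × Simulates t s

    simulates-refl : ∀ {s} → Simulates s s
    simulates-refl t = _ , t , ≃-refl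

    simulates-trans : ∀ {r s t} → Simulates r s → Simulates s t → Simulates r t
    simulates-trans f g r⟶ =
      let _ , s⟶ , p = f r⟶
          _ , t⟶ , q = g s⟶
      in _ , t⟶ , ≃-trans p q

    matches-trans : ∀ {r s t} → Matches r s → Matches s t → Matches r t
    matches-trans (f , f′) (g , g′) = simulates-trans f g , simulates-trans g′ f′

  module Forward {X : Step} where
    open Simulation (_─[ X ]→_)

    +ˡ′ : ∀ {x y u} → x ─[ X ]→ u → x + y ─[ X ]→ u
    +ˡ′ t = +ˡ t (→⇒⊆ t)

    +ʳ′ : ∀ {x y u} → x ─[ X ]→ u → y + x ─[ X ]→ u
    +ʳ′ t = +ʳ t (→⇒⊆ t)

    ·ˡ′ : ∀ {x y u} → x ─[ X ]→ u → x · y ─[ X ]→ u · y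
    ·ˡ′ t = ·ˡ t (→⇒⊆ t)

    +-comm-sim : ∀ {x y} → Simulates (x + y) (y + x)
    +-comm-sim (+ˡ t _) = _ , +ʳ′ t , ≃-refl
    +-comm-sim (+ʳ t _) = _ , +ˡ′ t , ≃-refl

    +-cong-sim : ∀ {x x′ y y′} → Simulates x x′ → Simulates y y′ → Simulates (x + y) (x′ + y′)
    +-cong-sim f g (+ˡ t _) = let _ , t′ , p = f t in _ , +ˡ′ t′ , p
    +-cong-sim f g (+ʳ t _) = let _ , t′ , p = g t in _ , +ʳ′ t′ , p

    -- The right factor survives a forward step unchanged, so its equivalence is carried over to the
    -- targets.
    ·-cong-sim : ∀ {x x′ y y′} → Simulates x x′ → y ≃ y′ → Simulates (x · y) (x′ · y′)
    ·-cong-sim f q (·ˡ t _) = let _ , t′ , p = f t in _ , ·ˡ′ t′ , ·-cong p q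

    ≃⇒matches : ∀ {s t} → s ≃ t → Matches s t
    ≃⇒matches +-comm = +-comm-sim , +-comm-sim
    ≃⇒matches +-assoc =
      (λ { (+ˡ (+ˡ t _) _) → _ , +ˡ′ t , ≃-refl
         ; (+ˡ (+ʳ t _) _) → _ , +ʳ′ (+ˡ′ t) , ≃-refl
         ; (+ʳ t _)        → _ , +ʳ′ (+ʳ′ t) , ≃-refl }) ,
      (λ { (+ˡ t _)        → _ , +ˡ′ (+ˡ′ t) , ≃-refl
         ; (+ʳ (+ˡ t _) _) → _ , +ˡ′ (+ʳ′ t) , ≃-refl
         ; (+ʳ (+ʳ t _) _) → _ , +ʳ′ t , ≃-refl })
    ≃⇒matches +-idem =
      (λ { (+ˡ t _) → _ , t , ≃-refl
         ; (+ʳ t _) → _ , t , ≃-refl }) ,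
      (λ t → _ , +ˡ′ t , ≃-refl)
    ≃⇒matches (·-distʳ-+ _) =
      (λ { (·ˡ (+ˡ t _) _) → _ , +ˡ′ (·ˡ′ t) , ≃-refl
         ; (·ˡ (+ʳ t _) _) → _ , +ʳ′ (·ˡ′ t) , ≃-refl }) ,
      (λ { (+ˡ (·ˡ t _) _) → _ , ·ˡ′ (+ˡ′ t) , ≃-refl
         ; (+ʳ (·ˡ t _) _) → _ , ·ˡ′ (+ʳ′ t) , ≃-refl })
    -- On either side a forward step would have to begin with a step of the common left factor.
    ≃⇒matches (·-distˡ-+ ¬t) =
      (λ { (·ˡ t _) → contradiction t ¬t }) ,
      (λ { (+ˡ (·ˡ t _) _) → contradiction t ¬t
         ; (+ʳ (·ˡ t _) _) → contradiction t ¬t })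
    -- The targets are still bracketed differently, so associativity relates them again.
    ≃⇒matches ·-assoc =
      (λ { (·ˡ (·ˡ t _) _) → _ , ·ˡ′ t , ·-assoc }) ,
      (λ { (·ˡ t _) → _ , ·ˡ′ (·ˡ′ t) , ≃-sym ·-assoc })
    ≃⇒matches ≃-refl = simulates-refl , simulates-refl
    ≃⇒matches (≃-sym p) = swap (≃⇒matches p)
    ≃⇒matches (≃-trans p q) = matches-trans (≃⇒matches p) (≃⇒matches q)
    ≃⇒matches (·-cong p q) =
      let f , f′ = ≃⇒matches p in ·-cong-sim f q , ·-cong-sim f′ (≃-sym q)
    ≃⇒matches (+-cong p q) =
      let f , f′ = ≃⇒matches p
          g , g′ = ≃⇒matches q
      in +-cong-sim f g , +-cong-sim f′ g′

  module Reverse {X : Step} {𝒦 : Keys X} where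
    open Simulation (_─[ X ⟦ 𝒦 ⟧]↠_)

    +ˡ′ : ∀ {x y u} → x ─[ X ⟦ 𝒦 ⟧]↠ u → x + y ─[ X ⟦ 𝒦 ⟧]↠ u
    +ˡ′ t = +ˡ t (↠⇒⊆ t)

    +ʳ′ : ∀ {x y u} → x ─[ X ⟦ 𝒦 ⟧]↠ u → y + x ─[ X ⟦ 𝒦 ⟧]↠ u
    +ʳ′ t = +ʳ t (↠⇒⊆ t)

    ·ʳ′ : ∀ {x y u} → x ─[ X ⟦ 𝒦 ⟧]↠ u → y · x ─[ X ⟦ 𝒦 ⟧]↠ y · u
    ·ʳ′ t = ·ʳ t (↠⇒⊆ t)

    +-comm-sim : ∀ {x y} → Simulates (x + y) (y + x)
    +-comm-sim (+ˡ t _) = _ , +ʳ′ t , ≃-refl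
    +-comm-sim (+ʳ t _) = _ , +ˡ′ t , ≃-refl

    +-cong-sim : ∀ {x x′ y y′} → Simulates x x′ → Simulates y y′ → Simulates (x + y) (x′ + y′)
    +-cong-sim f g (+ˡ t _) = let _ , t′ , p = f t in _ , +ˡ′ t′ , p
    +-cong-sim f g (+ʳ t _) = let _ , t′ , p = g t in _ , +ʳ′ t′ , p

    ·-cong-sim : ∀ {x x′ y y′} → x ≃ x′ → Simulates y y′ → Simulates (x · y) (x′ · y′)
    ·-cong-sim p g (·ʳ t _) = let _ , t′ , q = g t in _ , ·ʳ′ t′ , ·-cong p q

    ≃⇒matches : ∀ {s t} → s ≃ t → Matches s t
    ≃⇒matches +-comm = +-comm-sim , +-comm-sim
    ≃⇒matches +-assoc =
      (λ { (+ˡ (+ˡ t _) _) → _ , +ˡ′ t , ≃-refl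
         ; (+ˡ (+ʳ t _) _) → _ , +ʳ′ (+ˡ′ t) , ≃-refl
         ; (+ʳ t _)        → _ , +ʳ′ (+ʳ′ t) , ≃-refl }) ,
      (λ { (+ˡ t _)        → _ , +ˡ′ (+ˡ′ t) , ≃-refl
         ; (+ʳ (+ˡ t _) _) → _ , +ˡ′ (+ʳ′ t) , ≃-refl
         ; (+ʳ (+ʳ t _) _) → _ , +ʳ′ t , ≃-refl })
    ≃⇒matches +-idem =
      (λ { (+ˡ t _) → _ , t , ≃-refl
         ; (+ʳ t _) → _ , t , ≃-refl }) ,
      (λ t → _ , +ˡ′ t , ≃-refl)
    -- Reverse steps of a product act in its right factor, so either side would have to undo a step
    -- of `z`.
    ≃⇒matches (·-distʳ-+ ¬t) =
      (λ { (·ʳ t _) → contradiction t ¬t }) ,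
      (λ { (+ˡ (·ʳ t _) _) → contradiction t ¬t
         ; (+ʳ (·ʳ t _) _) → contradiction t ¬t })
    -- The reverse step resolves the choice and leaves the left factor in place, so both sides reach
    -- the same state.
    ≃⇒matches (·-distˡ-+ _) =
      (λ { (·ʳ (+ˡ t _) _) → _ , +ˡ′ (·ʳ′ t) , ≃-refl
         ; (·ʳ (+ʳ t _) _) → _ , +ʳ′ (·ʳ′ t) , ≃-refl }) ,
      (λ { (+ˡ (·ʳ t _) _) → _ , ·ʳ′ (+ˡ′ t) , ≃-refl
         ; (+ʳ (·ʳ t _) _) → _ , ·ʳ′ (+ʳ′ t) , ≃-refl })
    ≃⇒matches ·-assoc =
      (λ { (·ʳ t _) → _ , ·ʳ′ (·ʳ′ t) , ·-assoc }) ,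
      (λ { (·ʳ (·ʳ t _) _) → _ , ·ʳ′ t , ≃-sym ·-assoc })
    ≃⇒matches ≃-refl = simulates-refl , simulates-refl
    ≃⇒matches (≃-sym p) = swap (≃⇒matches p)
    ≃⇒matches (≃-trans p q) = matches-trans (≃⇒matches p) (≃⇒matches q)
    ≃⇒matches (·-cong p q) =
      let g , g′ = ≃⇒matches q in ·-cong-sim p g , ·-cong-sim (≃-sym p) g′
    ≃⇒matches (+-cong p q) =
      let f , f′ = ≃⇒matches p
          g , g′ = ≃⇒matches q
      in +-cong-sim f g , +-cong-sim f′ g′

  ≃-isFRStepBisimulation : IsFRStepBisimulation _≃_
  ≃-isFRStepBisimulation = record
    { forward→ = λ p s⟶ →
        let _ , t⟶ , q = proj₁ (Forward.≃⇒matches p) s⟶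
        -- The matching step has the same label, so the identity is the required pomset isomorphism.
        in _ , _ , t⟶ , ≅-refl , q
    ; forward← = λ p t⟶ →
        let _ , s⟶ , q = proj₂ (Forward.≃⇒matches p) t⟶
        -- The second half of a match relates the target of `t` to that of `s`, hence the reversal.
        in _ , _ , s⟶ , ≅-refl , ≃-sym q
    ; reverse→ = λ p s⟶ →
        let _ , t⟶ , q = proj₁ (Reverse.≃⇒matches p) s⟶
        in _ , _ , _ , t⟶ , ≅-refl , q
    ; reverse← = λ p t⟶ →
        let _ , s⟶ , q = proj₂ (Reverse.≃⇒matches p) t⟶
        in _ , _ , _ , s⟶ , ≅-refl , ≃-sym q
    }

theorem3p7 : ∀ {Λ : Set} (𝔼 : PrimeEventStructure Λ) →
    let open BARTC 𝔼 in
    ∀ (x y : BTerm) → ⊢ x ≐ y → x ≈ˢᶠʳ y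
theorem3p7 𝔼 x y ⊢x≐y ρ = _≃_ , ≃-isFRStepBisimulation , ⊢⇒≃ ⊢x≐y ρ
  where open Soundness 𝔼
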